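{- Let $\Sigma$ be a theory and let $A,B \subseteq \mathcal{T}_Y$ be finite. Then the following are equivalent: (1) $\Sigma \cup \{\emptyset \Rightarrow A\} \vdash \emptyset \Rightarrow B$; (2) there are $i_1,\ldots,i_n \in \mathbb{Z}$ such that $\Sigma \vdash \bigcup_{m=1}^n (A+i_m) \Rightarrow B$.
   Context: $Y$ is a non-empty finite set of attributes and $\mathcal{T}_Y = \{y^i \mid y \in Y, i \in \mathbb{Z}\}$; $M + j = \{y^{i+j} \mid y^i \in M\}$. A formula is $A \Rightarrow B$ with $A,B$ finite subsets of $\mathcal{T}_Y$; a theory is a set of formulas. Deduction rules (for arbitrary finite $A,B,C,D \subseteq \mathcal{T}_Y$, $i \in \mathbb{Z}$): (Ax) infer $A \cup B \Rightarrow A$; (Cut) from $A \Rightarrow B$ and $B \cup C \Rightarrow D$ infer $A \cup C \Rightarrow D$; (Shf) from $A \Rightarrow B$ infer $A+i \Rightarrow B+i$. $\Sigma \vdash A \Rightarrow B$ means there is a finite sequence of formulas ending with $A \Rightarrow B$ in which each member is in $\Sigma$ or is the conclusion of one of these rules applied to earlier members. -}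

module Defs where

open import Data.Integer using (ℤ) renaming (_+_ to _+ℤ_)
open import Data.List using (List; []; _∷_; _++_; map)
open import Data.List.Relation.Binary.BagAndSetEquality using (set; _∼[_]_; [_]-Equality)
open import Data.List.Relation.Unary.All using (All)
open import Data.Product using (∃; ∃₂; _×_; _,_)
open import Data.Sum using (_⊎_; inj₁; inj₂)
open import Data.Vec.Functional using (Vector; foldr)
open import Level using (Level; _⊔_; suc)
open import Relation.Binary using (IsEquivalence; Setoid; _Respects_)
open import Relation.Unary using (Pred)
import Data.List.Membership.Setoid as Membership

-- A finite subset is represented by a list of its elements; two lists denote
-- the same subset when they have the same members, which is the relation _≈_.
FinSubset : ∀ {a} → Set a → Set a
FinSubset = List

module _ {a} {X : Set a} where

  infix  4 _≈_
  infixr 6 _∪_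

  _≈_ : FinSubset X → FinSubset X → Set a
  A ≈ B = A ∼[ set ] B

  ∅ : FinSubset X
  ∅ = []

  _∪_ : FinSubset X → FinSubset X → FinSubset X
  _∪_ = _++_

  ⋃ : ∀ {n} → Vector (FinSubset X) n → FinSubset X
  ⋃ = foldr _∪_ ∅

-- (y , i) stands for yⁱ.
𝒯 : ∀ {y} → Set y → Set y
𝒯 Y = Y × ℤ

infixl 7 _+_

_+_ : ∀ {y} {Y : Set y} → FinSubset (𝒯 Y) → ℤ → FinSubset (𝒯 Y)
M + j = map (λ (y , i) → (y , i +ℤ j)) M

infix 5 _⇒_

record Formula {y} (Y : Set y) : Set y where
  constructor _⇒_
  field
    antecedent : FinSubset (𝒯 Y)
    consequent : FinSubset (𝒯 Y)

open Formula public

infix 4 _≋_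

record _≋_ {y} {Y : Set y} (φ ψ : Formula Y) : Set y where
  constructor _,_
  field
    antecedent-≈ : antecedent φ ≈ antecedent ψ
    consequent-≈ : consequent φ ≈ consequent ψ

open _≋_ public

module _ {y} (Y : Set y) where

  private module S = Setoid ([ set ]-Equality (𝒯 Y))

  ≋-isEquivalence : IsEquivalence (_≋_ {Y = Y})
  ≋-isEquivalence = record
    { refl  = λ {φ} → S.refl {antecedent φ} , S.refl {consequent φ}
    ; sym   = λ {φ} {ψ} (p , q) →
        S.sym {antecedent φ} {antecedent ψ} p ,
        S.sym {consequent φ} {consequent ψ} q
    ; trans = λ {φ} {ψ} {χ} (p , q) (p′ , q′) →
        S.trans {antecedent φ} {antecedent ψ} {antecedent χ} p p′ ,
        S.trans {consequent φ} {consequent ψ} {consequent χ} q q′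
    }

  formulaSetoid : Setoid y y
  formulaSetoid = record { isEquivalence = ≋-isEquivalence }

-- A set of formulas must not distinguish different listings of the same
-- antecedent or consequent.
record Theory {y} (Y : Set y) (ℓ : Level) : Set (y ⊔ suc ℓ) where
  field
    Contains : Pred (Formula Y) ℓ
    resp     : Contains Respects _≋_

open Theory public

module _ {y} {Y : Set y} where

  private module E = IsEquivalence (≋-isEquivalence Y)

  infixl 4 _∪ₜ_

  _∪ₜ_ : ∀ {ℓ₁ ℓ₂} → Theory Y ℓ₁ → Theory Y ℓ₂ → Theory Y (ℓ₁ ⊔ ℓ₂)
  Σ₁ ∪ₜ Σ₂ = record
    { Contains = λ φ → Contains Σ₁ φ ⊎ Contains Σ₂ φ
    ; resp     = λ { φ≋ψ (inj₁ p) → inj₁ (resp Σ₁ φ≋ψ p)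
                   ; φ≋ψ (inj₂ p) → inj₂ (resp Σ₂ φ≋ψ p) }
    }

  ❴_❵ : Formula Y → Theory Y y
  ❴ φ ❵ = record
    { Contains = φ ≋_
    ; resp     = λ ψ≋χ φ≋ψ → E.trans φ≋ψ ψ≋χ
    }

  data Rule : List (Formula Y) → Formula Y → Set y where
    Ax  : ∀ A B     → Rule [] (A ∪ B ⇒ A)
    Cut : ∀ A B C D → Rule ((A ⇒ B) ∷ (B ∪ C ⇒ D) ∷ []) (A ∪ C ⇒ D)
    Shf : ∀ A B i   → Rule ((A ⇒ B) ∷ []) (A + i ⇒ B + i)

  open Membership (formulaSetoid Y) using (_∈_)

  -- Membership and the conclusion are taken up to _≋_, so that rules act on
  -- formulas over finite sets rather than on their representing lists.
  Justified : ∀ {ℓ} → Theory Y ℓ → List (Formula Y) → Formula Y → Set (y ⊔ ℓ)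
  Justified Σ earlier φ =
    Contains Σ φ
    ⊎ (∃₂ λ premises ψ → Rule premises ψ × ψ ≋ φ × All (_∈ earlier) premises)

  -- The sequence is listed with its last formula at the head.
  data IsProof {ℓ} (Σ : Theory Y ℓ) : List (Formula Y) → Set (y ⊔ ℓ) where
    []  : IsProof Σ []
    _∷_ : ∀ {φ φs} → Justified Σ φs φ → IsProof Σ φs → IsProof Σ (φ ∷ φs)

  infix 3 _⊢_

  _⊢_ : ∀ {ℓ} → Theory Y ℓ → Formula Y → Set (y ⊔ ℓ)
  Σ ⊢ φ = ∃ λ φs → IsProof Σ (φ ∷ φs)

{-# OPTIONS --safe #-}
-- For (1) ⇒ (2), induct on the proof, strengthening the claim to arbitrary
-- formulas: if Σ ∪ {∅ ⇒ A} ⊢ E ⇒ F, then Σ ⊢ S ∪ E ⇒ F for a finite union S of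
-- shifts of A.  Cut takes the union of the two families of shifts, and Shf
-- shifts the whole family.  For (2) ⇒ (1), Shf derives ∅ ⇒ A + i for each i.
module Submission where

open import Defs
open import Data.Nat using (ℕ; NonZero)
open import Data.Integer using (ℤ; 0ℤ) renaming (_+_ to _+ℤ_)
open import Data.Integer.Properties using (+-assoc; +-identityʳ)
open import Data.Fin using (Fin; zero; suc)
open import Data.List using (List; []; _∷_; _++_; map; concatMap; length; lookup)
open import Data.List.Properties using (++-identityʳ; map-++; map-∘; map-cong; map-id; concatMap-++)
open import Data.List.Membership.Propositional.Properties using (∈-++⁻)
import Data.List.Membership.Setoid as Membership
open import Data.List.Relation.Binary.Subset.Propositional using (_⊆_)
open import Data.List.Relation.Binary.Subset.Propositional.Properties
  using (⊆-refl; ⊆-trans; ⊆-reflexive; xs⊆xs++ys; xs⊆ys++xs; ++⁺)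
open import Data.List.Relation.Unary.All as All using (All; []; _∷_)
open import Data.List.Relation.Unary.Any using (here)
open import Data.List.Relation.Unary.Any.Properties using (++⁺ˡ; ++⁺ʳ)
open import Data.Product using (∃; ∃₂; _×_; _,_; proj₂)
open import Data.Sum using (inj₁; inj₂; [_,_]′)
open import Data.Vec.Functional using (Vector)
open import Function.Base using (_∘_)
open import Function.Bundles using (_↔_; _⇔_; mk⇔; Equivalence)
open import Relation.Binary using (IsEquivalence; _Respects_)
open import Relation.Binary.PropositionalEquality
  using (_≡_; refl; sym; trans; cong; cong₂; subst)
open import Relation.Unary using (Pred)

module _ {a} {X : Set a} where

  ++-least : {A B C : List X} → A ⊆ C → B ⊆ C → A ++ B ⊆ C
  ++-least {A = A} p q = [ p , q ]′ ∘ ∈-++⁻ A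

  ⊆-antisym : {A B : FinSubset X} → A ⊆ B → B ⊆ A → A ≈ B
  ⊆-antisym p q = mk⇔ p q

  ≈⇒⊆ : {A B : FinSubset X} → A ≈ B → A ⊆ B
  ≈⇒⊆ e = Equivalence.to e

  ≈⇒⊇ : {A B : FinSubset X} → A ≈ B → B ⊆ A
  ≈⇒⊇ e = Equivalence.from e

module _ {y} {Y : Set y} where

  private
    module E = IsEquivalence (≋-isEquivalence Y)
    module M = Membership (formulaSetoid Y)

  module _ {ℓ} {Σ : Theory Y ℓ} where

    -- Since the last formula is at the head, `ψs` is the earlier part. Members of `φs` only gain
    -- earlier formulas, so their justifications survive.
    ++-isProof : ∀ {φs ψs} → IsProof Σ φs → IsProof Σ ψs → IsProof Σ (φs ++ ψs)
    ++-isProof [] qs = qs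
    ++-isProof (inj₁ c ∷ ps) qs = inj₁ c ∷ ++-isProof ps qs
    ++-isProof (inj₂ (_ , _ , r , e , prems) ∷ ps) qs =
      inj₂ (_ , _ , r , e , All.map ++⁺ˡ prems) ∷ ++-isProof ps qs

    -- A rule looks up all its premises in one sequence, so separate proofs have to be merged before
    -- it can be applied.
    jointProof : ∀ {φs} → All (Σ ⊢_) φs → ∃ λ ψs → IsProof Σ ψs × All (M._∈ ψs) φs
    jointProof [] = [] , [] , []
    jointProof ((φs , p) ∷ ps) with ψs , q , φs∈ψs ← jointProof ps =
      _ , ++-isProof p q , here E.refl ∷ All.map (++⁺ʳ (_ ∷ φs)) φs∈ψs

    ⊢-hyp : ∀ {φ} → Contains Σ φ → Σ ⊢ φ
    ⊢-hyp c = [] , inj₁ c ∷ []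

    ⊢-rule : ∀ {premises ψ φ} → Rule premises ψ → ψ ≋ φ → All (Σ ⊢_) premises → Σ ⊢ φ
    ⊢-rule r e ps with φs , p , prems ← jointProof ps =
      φs , inj₂ (_ , _ , r , e , prems) ∷ p

    -- Rule induction. Premises may occur anywhere earlier, so `P` is proved for every member of the
    -- sequence. Premises and conclusions match only up to `_≋_`, hence the condition on `P`.
    ⊢-elim : ∀ {p} {P : Pred (Formula Y) p} → P Respects _≋_ →
             (∀ {φ} → Contains Σ φ → P φ) →
             (∀ {premises φ} → Rule premises φ → All P premises → P φ) →
             ∀ {φ} → Σ ⊢ φ → P φ
    ⊢-elim {P = P} P-resp hyp rule = All.head ∘ all ∘ proj₂
      where
      all : ∀ {φs} → IsProof Σ φs → All P φs
      all [] = []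
      all (inj₁ c ∷ ps) = hyp c ∷ all ps
      all (inj₂ (_ , _ , r , e , prems) ∷ ps) =
        P-resp e (rule r (All.map (All.lookupₛ (formulaSetoid Y) P-resp (all ps)) prems)) ∷ all ps

    -- If `B ⊆ A`, then `B ∪ A` lists the same set as `A`, so this is an instance of `Ax` up to
    -- `_≋_`.
    ⊢-⊇ : ∀ {A B} → B ⊆ A → Σ ⊢ A ⇒ B
    ⊢-⊇ {A} {B} B⊆A = ⊢-rule (Ax B A)
      (⊆-antisym (++-least B⊆A ⊆-refl) (xs⊆ys++xs A B) , ⊆-antisym ⊆-refl ⊆-refl) []

    ⊢-cut : ∀ {A B C D} → Σ ⊢ A ⇒ B → Σ ⊢ B ∪ C ⇒ D → Σ ⊢ A ∪ C ⇒ D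
    ⊢-cut p q = ⊢-rule (Cut _ _ _ _) E.refl (p ∷ q ∷ [])

    ⊢-shift : ∀ {A B} i → Σ ⊢ A ⇒ B → Σ ⊢ A + i ⇒ B + i
    ⊢-shift i p = ⊢-rule (Shf _ _ i) E.refl (p ∷ [])

    ⊢-trans : ∀ {A B C} → Σ ⊢ A ⇒ B → Σ ⊢ B ⇒ C → Σ ⊢ A ⇒ C
    ⊢-trans {A} {B} {C} p q = subst (λ S → Σ ⊢ S ⇒ C) (++-identityʳ A)
      (⊢-cut p (subst (λ S → Σ ⊢ S ⇒ C) (sym (++-identityʳ B)) q))

    ⊢-mono : ∀ {A A′ B B′} → A ⊆ A′ → B′ ⊆ B → Σ ⊢ A ⇒ B → Σ ⊢ A′ ⇒ B′
    ⊢-mono A⊆A′ B′⊆B p = ⊢-trans (⊢-⊇ A⊆A′) (⊢-trans p (⊢-⊇ B′⊆B))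

    ⊢-∪ : ∀ {A B C} → Σ ⊢ A ⇒ B → Σ ⊢ A ⇒ C → Σ ⊢ A ⇒ B ∪ C
    ⊢-∪ {A} {B} {C} p q =
      -- Read from the inside: starting at `B ∪ C ⇒ B ∪ C`, cutting with `p` replaces `B` by `A`,
      -- cutting with `q` replaces `C` by `A`, and `A ∪ A` is contracted.
      ⊢-mono (++-least ⊆-refl ⊆-refl) ⊆-refl
        (⊢-cut q (⊢-mono (++-least (xs⊆ys++xs A C) (xs⊆xs++ys C A)) ⊆-refl
          (⊢-cut p (⊢-⊇ ⊆-refl))))

    ⊢-⋃ : ∀ {A n} {Bs : Vector (FinSubset (𝒯 Y)) n} → (∀ m → Σ ⊢ A ⇒ Bs m) → Σ ⊢ A ⇒ ⋃ Bs
    ⊢-⋃ {n = ℕ.zero}  ps = ⊢-⊇ λ ()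
    ⊢-⋃ {n = ℕ.suc _} ps = ⊢-∪ (ps zero) (⊢-⋃ (ps ∘ suc))

    ⊢-resp : (Σ ⊢_) Respects _≋_
    ⊢-resp (e , f) = ⊢-mono (≈⇒⊆ e) (≈⇒⊇ f)

  ⊢-extend : ∀ {ℓ₁ ℓ₂} {Σ₁ : Theory Y ℓ₁} {Σ₂ : Theory Y ℓ₂} →
             (∀ {φ} → Contains Σ₁ φ → Contains Σ₂ φ) → ∀ {φ} → Σ₁ ⊢ φ → Σ₂ ⊢ φ
  ⊢-extend inc = ⊢-elim ⊢-resp (⊢-hyp ∘ inc) (λ r → ⊢-rule r E.refl)

  infixl 7 _⊕_

  -- With the shifts kept in a list, `Cut` concatenates families and `Shf` maps over one; `⊕-lookup`
  -- returns to indexed unions.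
  _⊕_ : FinSubset (𝒯 Y) → List ℤ → FinSubset (𝒯 Y)
  A ⊕ is = concatMap (A +_) is

  +-0 : ∀ (A : FinSubset (𝒯 Y)) → A + 0ℤ ≡ A
  +-0 A = trans (map-cong (λ (z , i) → cong (z ,_) (+-identityʳ i)) A) (map-id A)

  +-+ : ∀ (A : FinSubset (𝒯 Y)) i j → A + i + j ≡ A + (i +ℤ j)
  +-+ A i j = trans (sym (map-∘ A)) (map-cong (λ (z , k) → cong (z ,_) (+-assoc k i j)) A)

  ⊕-+ : ∀ A is j → (A ⊕ is) + j ≡ A ⊕ map (_+ℤ j) is
  ⊕-+ A []       j = refl
  ⊕-+ A (i ∷ is) j = trans (map-++ _ (A + i) (A ⊕ is)) (cong₂ _++_ (+-+ A i j) (⊕-+ A is j))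

  ⊕-lookup : ∀ A is → A ⊕ is ≡ ⋃ (λ m → A + lookup is m)
  ⊕-lookup A []       = refl
  ⊕-lookup A (i ∷ is) = cong (A + i ++_) (⊕-lookup A is)

  module _ {ℓ} {Σ : Theory Y ℓ} {A : FinSubset (𝒯 Y)} where

    -- The antecedent `E` is arbitrary because a proof of `∅ ⇒ B` may cut through premises with
    -- non-empty antecedents.
    DerivableFromShifts : Pred (Formula Y) _
    DerivableFromShifts (E ⇒ F) = ∃ λ is → Σ ⊢ (A ⊕ is) ∪ E ⇒ F

    shifts-resp : DerivableFromShifts Respects _≋_
    shifts-resp (e , f) (is , p) = is , ⊢-mono (++⁺ ⊆-refl (≈⇒⊆ e)) (≈⇒⊇ f) p

    shifts-hyp : ∀ {φ} → Contains (Σ ∪ₜ ❴ ∅ ⇒ A ❵) φ → DerivableFromShifts φ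
    shifts-hyp (inj₁ c)       = [] , ⊢-hyp c
    -- The added hypothesis uses one copy of `A`, taken as its shift by zero.
    shifts-hyp (inj₂ (e , f)) = 0ℤ ∷ [] ,
      ⊢-⊇ (⊆-trans (≈⇒⊇ f) (⊆-trans (⊆-reflexive (sym (+-0 A)))
        (⊆-trans (xs⊆xs++ys _ _) (xs⊆xs++ys _ _))))

    shifts-rule : ∀ {premises φ} → Rule premises φ →
                  All DerivableFromShifts premises → DerivableFromShifts φ
    shifts-rule (Ax E F) [] = [] , ⊢-⊇ (xs⊆xs++ys E F)
    shifts-rule (Cut E F G H) ((is , p) ∷ (js , q) ∷ []) = is ++ js ,
      subst (λ S → Σ ⊢ S ∪ E ∪ G ⇒ H) (sym (concatMap-++ (A +_) is js))
        (⊢-mono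
          (++-least (++⁺ (xs⊆xs++ys I J) (xs⊆xs++ys E G))
                    (++⁺ (xs⊆ys++xs J I) (xs⊆ys++xs G E)))
          ⊆-refl
          -- The cut formula `F` must come first, so `J ∪ F ∪ G` is reordered to `F ∪ (J ∪ G)`. The
          -- cut leaves `(I ∪ E) ∪ (J ∪ G)`, regrouped by the outer `⊢-mono`.
          (⊢-cut p (⊢-mono
            (++-least (⊆-trans (xs⊆xs++ys J G) (xs⊆ys++xs (J ++ G) F))
                      (++⁺ ⊆-refl (xs⊆ys++xs G J)))
            ⊆-refl q)))
      where
      I = A ⊕ is
      J = A ⊕ js
    shifts-rule (Shf E F j) ((is , p) ∷ []) = map (_+ℤ j) is ,
      subst (λ S → Σ ⊢ S ⇒ F + j)
        (trans (map-++ _ (A ⊕ is) E) (cong (_++ E + j) (⊕-+ A is j)))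
        (⊢-shift j p)

    ⊢-shifts : ∀ {φ} → Σ ∪ₜ ❴ ∅ ⇒ A ❵ ⊢ φ → DerivableFromShifts φ
    ⊢-shifts = ⊢-elim shifts-resp shifts-hyp shifts-rule

theorem11 : ∀ {y ℓ} {Y : Set y} (k : ℕ) .{{_ : NonZero k}} → Y ↔ Fin k →
    (Σ : Theory Y ℓ) (A B : FinSubset (𝒯 Y)) →
    (Σ ∪ₜ ❴ ∅ ⇒ A ❵ ⊢ ∅ ⇒ B) ⇔ (∃₂ λ (n : ℕ) (i : Vector ℤ n) → Σ ⊢ ⋃ (λ m → A + i m) ⇒ B)
theorem11 {Y = Y} k _ Σ A B = mk⇔ to from
  where
  to : Σ ∪ₜ ❴ ∅ ⇒ A ❵ ⊢ ∅ ⇒ B → ∃₂ λ (n : ℕ) (i : Vector ℤ n) → Σ ⊢ ⋃ (λ m → A + i m) ⇒ B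
  to p with is , q ← ⊢-shifts p = length is , lookup is ,
    subst (λ S → Σ ⊢ S ⇒ B) (trans (++-identityʳ (A ⊕ is)) (⊕-lookup A is)) q

  from : (∃₂ λ (n : ℕ) (i : Vector ℤ n) → Σ ⊢ ⋃ (λ m → A + i m) ⇒ B) → Σ ∪ₜ ❴ ∅ ⇒ A ❵ ⊢ ∅ ⇒ B
  from (n , i , p) = ⊢-trans
    -- `∅ + i m` computes to `∅`, so shifting the hypothesis keeps its antecedent empty.
    (⊢-⋃ λ m → ⊢-shift (i m) (⊢-hyp (inj₂ (IsEquivalence.refl (≋-isEquivalence Y)))))
    (⊢-extend inj₁ p)
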